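{- Fix a finite alphabet $\Sigma$ whose size is a constant. There is a deterministic algorithm which, given as input a rooted binary tree $T=(V,E)$ on $n>4$ vertices together with a label set $S_v\subseteq\Sigma$ for every vertex $v\in V$, runs in time $O(n^3)$ and outputs a permutation (linear ordering) $P_v$ of $S_v$ for every $v\in V$ such that $$\sum_{uv\in E}|P_u\wedge P_v|\;\ge\;\Bigl(1-\frac{1}{\log\log n}\Bigr)\,OPT_{CP}(T),$$ where $OPT_{CP}(T)$ is the maximum of $\sum_{uv\in E}|Q_u\wedge Q_v|$ over all choices of permutations $Q_v$ of $S_v$, $v\in V$. In particular, the Common Prefix problem on binary trees admits a polynomial-time $(1-o(1))$-factor approximation algorithm.
   Context: Common Prefix problem on a tree: given a tree $T=(V,E)$ in which each vertex $v$ carries a finite set of labels $S_v\subseteq\Sigma$, choose for each vertex $v$ a permutation $P_v$ of $S_v$ (a sequence listing each element of $S_v$ exactly once) so as to maximize the total benefit $\sum_{uv\in E}|P_u\wedge P_v|$. Here $P_u\wedge P_v$ denotes the longest common prefix of the two sequences $P_u$ and $P_v$, and $|P_u\wedge P_v|$ is its length, called the benefit of the edge $uv$. A binary tree is a rooted tree in which every vertex has at most two children. Logarithms are to base $2$. The alphabet size $|\Sigma|$ is regarded as a constant, so the constant hidden in $O(n^3)$ may depend on $|\Sigma|$. -}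

module Defs where

open import Data.Bool using (Bool; true; false; if_then_else_)
open import Data.Fin using (Fin; toℕ)
import Data.Fin as Fin
open import Data.Fin.Subset using (Subset) renaming (_∈_ to _∈ˢ_)
open import Data.Integer using (+_; -[1+_])
open import Data.List using (List; []; _∷_; _++_; _∷ʳ_; length; map; concatMap)
open import Data.Nat.ListAction using (sum)
open import Data.List.Membership.Propositional using (_∈_)
open import Data.List.Relation.Unary.Unique.Propositional using (Unique)
open import Data.Nat using (ℕ; zero; suc; _+_; _*_; _∸_; _≤_; _≡ᵇ_)
open import Data.Product using (Σ-syntax; ∃-syntax; _×_; _,_; uncurry)
import Data.Product as Product
open import Data.Rational as ℚ using (ℚ; 0ℚ; 1ℚ; Positive; ↥_; ↧ₙ_)
open import Data.Rational.Properties using (pos⇒nonZero)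
import Data.Vec as Vec
open import Function.Bundles using (_⇔_)
open import Relation.Binary.PropositionalEquality using (_≡_; _≢_)
open import Relation.Nullary using (yes; no)
open import Algebra.Definitions.RawSemiring ℚ.+-*-rawSemiring using (_^_)

------------------------------------------------------------------------
-- Rooted binary trees

-- The order of the two children of node₂ plays no role in the problem.
data BinaryTree : Set where
  node₀ : BinaryTree
  node₁ : BinaryTree → BinaryTree
  node₂ : BinaryTree → BinaryTree → BinaryTree

data Vertex : BinaryTree → Set where
  root  : ∀ {T} → Vertex T
  below : ∀ {T} → Vertex T → Vertex (node₁ T)
  left  : ∀ {T U} → Vertex T → Vertex (node₂ T U)
  right : ∀ {T U} → Vertex U → Vertex (node₂ T U)

-- Every vertex once, in preorder.
vertices : (T : BinaryTree) → List (Vertex T)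
vertices node₀       = root ∷ []
vertices (node₁ T)   = root ∷ map below (vertices T)
vertices (node₂ T U) = root ∷ map left (vertices T) ++ map right (vertices U)

-- Every edge once, as a pair (parent , child).
edges : (T : BinaryTree) → List (Vertex T × Vertex T)
edges node₀       = []
edges (node₁ T)   = (root , below root) ∷ map (Product.map below below) (edges T)
edges (node₂ T U) = (root , left root) ∷ (root , right root) ∷
                    map (Product.map left left) (edges T) ++
                    map (Product.map right right) (edges U)

size : BinaryTree → ℕ
size T = length (vertices T)

numChildren : ∀ {T} → Vertex T → ℕ
numChildren {node₀}     root      = 0
numChildren {node₁ _}   root      = 1
numChildren {node₂ _ _} root      = 2
numChildren             (below v) = numChildren v
numChildren             (left v)  = numChildren v
numChildren             (right v) = numChildren v

------------------------------------------------------------------------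
-- The Common Prefix problem over the alphabet Fin k

Labels : ℕ → BinaryTree → Set
Labels k T = Vertex T → Subset k

Sequences : ℕ → BinaryTree → Set
Sequences k T = Vertex T → List (Fin k)

infixr 6 _∧_
_∧_ : ∀ {k} → List (Fin k) → List (Fin k) → List (Fin k)
[]       ∧ _        = []
(_ ∷ _)  ∧ []       = []
(x ∷ xs) ∧ (y ∷ ys) with x Fin.≟ y
... | yes _ = x ∷ (xs ∧ ys)
... | no  _ = []

IsPermutationOf : ∀ {k} → Subset k → List (Fin k) → Set
IsPermutationOf S xs = Unique xs × (∀ x → x ∈ xs ⇔ x ∈ˢ S)

IsSolution : ∀ {k T} → Labels k T → Sequences k T → Set
IsSolution S P = ∀ v → IsPermutationOf (S v) (P v)

benefit : ∀ {k T} → Sequences k T → ℕ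
benefit {T = T} P = sum (map (uncurry λ u v → length (P u ∧ P v)) (edges T))

IsOPT : ∀ {k T} → Labels k T → ℕ → Set
IsOPT S m = (∃[ Q ] IsSolution S Q × benefit Q ≡ m)
          × (∀ Q → IsSolution S Q → benefit Q ≤ m)

------------------------------------------------------------------------
-- Random access machine with the usual uniform cost measure, in structured
-- form (while and if instead of jumps).  There is a read-only input array, a
-- working memory indexed by ℕ (initially all 0), and a write-only output
-- stream.  Operations are those of the Cook–Reckhow RAM: constants, direct and
-- indirect addressing, addition, (truncated) subtraction, and test for zero.

data Expr : Set where
  lit     : ℕ → Expr
  inp mem : Expr → Expr
  _⊕_ _⊖_ : Expr → Expr → Expr

data Program : Set where
  skip  : Program
  store : (address value : Expr) → Program
  print : Expr → Program
  _⨾_   : Program → Program → Program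
  if    : Expr → Program → Program → Program
  while : Expr → Program → Program

Memory : Set
Memory = ℕ → ℕ

_[_≔_] : Memory → ℕ → ℕ → Memory
(m [ a ≔ x ]) i = if i ≡ᵇ a then x else m i

-- Cells beyond the end of the input read as 0.
at : List ℕ → ℕ → ℕ
at []       _       = 0
at (x ∷ _)  zero    = x
at (_ ∷ xs) (suc i) = at xs i

⟦_⟧ : Expr → List ℕ → Memory → ℕ
⟦ lit x ⟧ I m = x
⟦ inp e ⟧ I m = at I (⟦ e ⟧ I m)
⟦ mem e ⟧ I m = m (⟦ e ⟧ I m)
⟦ e ⊕ f ⟧ I m = ⟦ e ⟧ I m + ⟦ f ⟧ I m
⟦ e ⊖ f ⟧ I m = ⟦ e ⟧ I m ∸ ⟦ f ⟧ I m

cost : Expr → ℕ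
cost (lit _) = 1
cost (inp e) = suc (cost e)
cost (mem e) = suc (cost e)
cost (e ⊕ f) = suc (cost e + cost f)
cost (e ⊖ f) = suc (cost e + cost f)

State : Set
State = Memory × List ℕ

-- Exec I A s t s′: on input I, program A started in state s halts after
-- exactly t steps in state s′.
data Exec (I : List ℕ) : Program → State → ℕ → State → Set where
  skip   : ∀ {s} → Exec I skip s 1 s
  store  : ∀ {a e m o} →
           Exec I (store a e) (m , o) (suc (cost a + cost e))
                (m [ ⟦ a ⟧ I m ≔ ⟦ e ⟧ I m ] , o)
  print  : ∀ {e m o} →
           Exec I (print e) (m , o) (suc (cost e)) (m , o ∷ʳ ⟦ e ⟧ I m)
  seq    : ∀ {A B s s′ s″ t u} →
           Exec I A s t s′ → Exec I B s′ u s″ → Exec I (A ⨾ B) s (t + u) s″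
  if-yes : ∀ {e A B m o s′ t} → ⟦ e ⟧ I m ≢ 0 →
           Exec I A (m , o) t s′ → Exec I (if e A B) (m , o) (suc (cost e + t)) s′
  if-no  : ∀ {e A B m o s′ t} → ⟦ e ⟧ I m ≡ 0 →
           Exec I B (m , o) t s′ → Exec I (if e A B) (m , o) (suc (cost e + t)) s′
  again  : ∀ {e A m o s′ s″ t u} → ⟦ e ⟧ I m ≢ 0 →
           Exec I A (m , o) t s′ → Exec I (while e A) s′ u s″ →
           Exec I (while e A) (m , o) (suc (cost e + t + u)) s″
  done   : ∀ {e A m o} → ⟦ e ⟧ I m ≡ 0 →
           Exec I (while e A) (m , o) (suc (cost e)) (m , o)

-- On input I, program A halts after t steps with output O.
RunsTo : Program → (I O : List ℕ) (t : ℕ) → Set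
RunsTo A I O t = ∃[ m ] Exec I A ((λ _ → 0) , []) t (m , O)

-- n, followed by one block per vertex in preorder: its number of children and
-- the k bits of the characteristic vector of its label set.  The numbers of
-- children in preorder determine the tree.
encodeInput : ∀ {k T} → Labels k T → List ℕ
encodeInput {T = T} S = size T ∷ concatMap block (vertices T)
  where
  bit : Bool → ℕ
  bit true  = 1
  bit false = 0

  block : Vertex T → List ℕ
  block v = numChildren v ∷ map bit (Vec.toList (S v))

-- For each vertex in preorder: the length of its sequence, then its entries.
encodeOutput : ∀ {k T} → Sequences k T → List ℕ
encodeOutput {T = T} P = concatMap (λ v → length (P v) ∷ map toℕ (P v)) (vertices T)

------------------------------------------------------------------------
-- Real numbers, given by their open lower cuts in ℚ

fromℕℚ : ℕ → ℚ
fromℕℚ n = + n ℚ./ 1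

LowerReal : Set₁
LowerReal = ℚ → Set

infix 4 _≤ᴿ_
_≤ᴿ_ : LowerReal → LowerReal → Set
X ≤ᴿ Y = ∀ q → X q → Y q

fromℕ : ℕ → LowerReal
fromℕ n q = q ℚ.< fromℕℚ n

-- 2^ q < r for r > 0: with q = a / b this says 2 ^ a < r ^ b, where for
-- negative a the power of 2 is moved to the other side.
2^_<_ : ℚ → ℚ → Set
2^ q < r with ↥ q
... | + a      = fromℕℚ 2 ^ a ℚ.< r ^ (↧ₙ q)
... | -[1+ a ] = 1ℚ ℚ.< fromℕℚ 2 ^ suc a ℚ.* r ^ (↧ₙ q)

-- Meaningful for X > 0.
log₂ : LowerReal → LowerReal
log₂ X q = Σ[ r ∈ ℚ ] X r × 0ℚ ℚ.< r × 2^ q < r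

-- The number 1 - 1 / x, for x > 0: the map is continuous and increasing there,
-- so p < 1 - 1 / x iff p < 1 - 1 / q for some rational q with 0 < q < x.
1-1/_ : LowerReal → LowerReal
(1-1/ X) p = Σ[ q ∈ ℚ ] Σ[ q>0 ∈ Positive q ]
               X q × p ℚ.< 1ℚ ℚ.- (ℚ.1/ q) {{pos⇒nonZero q {{q>0}}}}

infixl 7 _·_
_·_ : LowerReal → ℕ → LowerReal
(X · m) p = Σ[ q ∈ ℚ ] X q × p ℚ.< q ℚ.* fromℕℚ m

------------------------------------------------------------------------
-- ε n = o(1)

TendsToZero : (ℕ → ℚ) → Set
TendsToZero ε = ∀ δ → 0ℚ ℚ.< δ → ∃[ N ] (∀ n → N ≤ n → ℚ.∣ ε n ∣ ℚ.< δ)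

{-# OPTIONS --safe #-}

-- Since the alphabet is fixed, there are only finitely many candidate words for
-- a vertex, so dynamic programming over the tree computes an exact optimum in
-- linear time, which a fortiori is an approximation with the required factor.
-- A first pass, in reverse preorder, stores for every vertex v and every word u
-- the optimal benefit of the subtree of v including the edge to its parent, if
-- the parent has the sequence u.  A second pass, in preorder, chooses at every
-- vertex a word attaining the stored optimum for the word chosen at its parent.
-- All loops over words and label sets are unrolled into the program.
module Submission where

open import Defs
import Algebra.Properties.CommutativeSemigroup as CommSemigroupProperties
open import Data.Bool using (Bool; true; false)
open import Data.Empty using (⊥)
open import Data.Fin as Fin using (Fin; zero; suc; toℕ)
open import Data.Fin.Properties using (toℕ<n; toℕ-injective; injective⇒≤; all?)
open import Data.Fin.Subset using (Subset)
open import Data.Fin.Subset.Properties using () renaming (_∈?_ to _∈ˢ?_)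
open import Data.List
  using (List; []; _∷_; [_]; _++_; _∷ʳ_; length; map; concatMap; foldr; allFin; lookup;
        filter; cartesianProductWith)
open import Data.List.Membership.Propositional using (_∈_)
open import Data.List.Membership.Propositional.Properties
  using (∈-allFin; ∈-map⁺; ∈-map⁻; foldr-selective; ∈-lookup; ∈-filter⁺; ∈-filter⁻;
        ∈-cartesianProductWith⁺)
open import Data.List.Properties
  using (++-assoc; ++-identityʳ; concatMap-cong; concatMap-map; concatMap-++; map-∘;
        map-++; map-cong; length-map; length-++)
import Data.List.Relation.Unary.All as All
open import Data.List.Relation.Unary.AllPairs using (_∷_)
open import Data.List.Relation.Unary.Any using (here; there; index)
open import Data.List.Relation.Unary.Any.Properties using (lookup-index)
open import Data.List.Relation.Unary.Unique.Propositional using (Unique)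
open import Data.List.Relation.Unary.Unique.Propositional.Properties using (filter⁺; allFin⁺)
open import Data.Nat using (ℕ; zero; suc; _+_; _*_; _∸_; _^_; _⊔_; _≤_; _<_; _≡ᵇ_; z≤n; s≤s)
open import Data.Nat.DivMod using (_%_; [m+kn]%n≡m%n; m<n⇒m%n≡m)
open import Data.Nat.ListAction using (sum)
open import Data.Nat.ListAction.Properties using (sum-++)
open import Data.Nat.Properties
open import Data.Nat.Solver using (module +-*-Solver)
open import Data.Product using (Σ-syntax; ∃-syntax; _×_; _,_; proj₁; proj₂)
open import Data.Rational as ℚ using (ℚ; 1ℚ)
import Data.Rational.Properties as ℚ
open import Data.Sum using (_⊎_; inj₁; inj₂)
open import Data.Unit using (⊤; tt)
open import Data.Vec as Vec using ([]; _∷_)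
open import Data.Vec.Properties using (length-toList)
open import Function using (_∘_; case_of_; Injective; _⇔_; mk⇔; Equivalence)
open import Relation.Binary.PropositionalEquality
  using (_≡_; _≢_; refl; sym; trans; cong; cong₂; subst; module ≡-Reasoning)
open import Relation.Nullary using (Dec; ¬_; yes; no; contradiction)
open import Relation.Nullary.Decidable using (map′; _×-dec_; _→-dec_)

-- Memory updates

update-same : ∀ m a x → (m [ a ≔ x ]) a ≡ x
update-same m a x with a ≡ᵇ a | ≡⇒≡ᵇ a a refl
... | true | _ = refl

update-other : ∀ m {a i} x → i ≢ a → (m [ a ≔ x ]) i ≡ m i
update-other m {a} {i} x i≢a with i ≡ᵇ a | ≡ᵇ⇒≡ i a
... | false | _   = refl
... | true  | i≡a = contradiction (i≡a tt) i≢a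

-- Execution of programs

-- The running time is hidden here, because for loop-free programs `time≤maxTime` recovers a bound
-- from the program text alone.
Runs : List ℕ → Program → State → State → Set
Runs I A s s′ = ∃[ t ] Exec I A s t s′

infixr 5 _⨟_
_⨟_ : ∀ {I A B s s′ s″} → Runs I A s s′ → Runs I B s′ s″ → Runs I (A ⨾ B) s s″
(_ , a) ⨟ (_ , b) = _ , seq a b

runs-store : ∀ {I a e m o x y} → ⟦ a ⟧ I m ≡ x → ⟦ e ⟧ I m ≡ y →
             Runs I (store a e) (m , o) (m [ x ≔ y ] , o)
runs-store refl refl = _ , store

LoopFree : Program → Set
LoopFree skip        = ⊤
LoopFree (store _ _) = ⊤
LoopFree (print _)   = ⊤
LoopFree (A ⨾ B)     = LoopFree A × LoopFree B
LoopFree (if _ A B)  = LoopFree A × LoopFree B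
LoopFree (while _ _) = ⊥

-- Costs of expressions are syntactic and a conditional takes the larger branch, so neither input
-- nor memory enters. The value at `while` is a placeholder: the bound is claimed for loop-free
-- programs only.
maxTime : Program → ℕ
maxTime skip        = 1
maxTime (store a e) = suc (cost a + cost e)
maxTime (print e)   = suc (cost e)
maxTime (A ⨾ B)     = maxTime A + maxTime B
maxTime (if e A B)  = suc (cost e + (maxTime A ⊔ maxTime B))
maxTime (while _ _) = 0

time≤maxTime : ∀ {I A s t s′} → LoopFree A → Exec I A s t s′ → t ≤ maxTime A
time≤maxTime _       skip  = ≤-refl
time≤maxTime _       store = ≤-refl
time≤maxTime _       print = ≤-refl
time≤maxTime (a , b) (seq x y) = +-mono-≤ (time≤maxTime a x) (time≤maxTime b y)
time≤maxTime (a , b) (if-yes {e = e} _ x) =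
  s≤s (+-monoʳ-≤ (cost e) (≤-trans (time≤maxTime a x) (m≤m⊔n _ _)))
time≤maxTime (a , b) (if-no {e = e} _ x) =
  s≤s (+-monoʳ-≤ (cost e) (≤-trans (time≤maxTime b x) (m≤n⊔m _ _)))

-- Nothing is said about the guard in the final state, so that rounds spent on consecutive subtrees
-- can be concatenated and the loop closed only at the very end.
data Iterations (I : List ℕ) (e : Expr) (A : Program) : ℕ → State → State → Set where
  []   : ∀ {s} → Iterations I e A 0 s s
  step : ∀ {n m o s′ s″} → ⟦ e ⟧ I m ≢ 0 → Runs I A (m , o) s′ →
         Iterations I e A n s′ s″ → Iterations I e A (suc n) (m , o) s″

infixr 5 _++ᴵ_
_++ᴵ_ : ∀ {I e A n n′ s s′ s″} → Iterations I e A n s s′ →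
        Iterations I e A n′ s′ s″ → Iterations I e A (n + n′) s s″
[]         ++ᴵ ys = ys
step p x xs ++ᴵ ys = step p x (xs ++ᴵ ys)

castᴵ : ∀ {I e A n n′ s m o o′} → n ≡ n′ → o ≡ o′ →
        Iterations I e A n s (m , o) → Iterations I e A n′ s (m , o′)
castᴵ refl refl xs = xs

iterationTime : Expr → Program → ℕ
iterationTime e A = suc (cost e + maxTime A)

-- The last, failing test of the guard accounts for the extra one in `suc n`.
runs-while : ∀ {I e A n s m o} → LoopFree A → Iterations I e A n s (m , o) → ⟦ e ⟧ I m ≡ 0 →
             ∃[ t ] Exec I (while e A) s t (m , o) × t ≤ suc n * iterationTime e A
runs-while {e = e} _ [] stop =
  _ , done stop , s≤s (≤-trans (m≤m+n (cost e) _) (m≤m+n _ 0))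
runs-while {e = e} lf (step go (_ , x) xs) stop with runs-while lf xs stop
... | _ , exec , t≤ =
  _ , again go x exec , +-mono-≤ (s≤s (+-monoʳ-≤ (cost e) (time≤maxTime lf x))) t≤

-- Program combinators

-- The machine cannot multiply, so a product with a constant is unrolled into a sum.
times : ℕ → Expr → Expr
times zero    e = lit 0
times (suc n) e = e ⊕ times n e

eval-times : ∀ n e I m → ⟦ times n e ⟧ I m ≡ n * ⟦ e ⟧ I m
eval-times zero    e I m = refl
eval-times (suc n) e I m = cong (⟦ e ⟧ I m +_) (eval-times n e I m)

maximum : List ℕ → ℕ
maximum = foldr _⊔_ 0

-- Truncated subtraction replaces a comparison, by `m + (n ∸ m) ≡ m ⊔ n`.
maxᴱ : List Expr → Expr
maxᴱ []       = lit 0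
maxᴱ (e ∷ es) = e ⊕ (maxᴱ es ⊖ e)

m+[n∸m]≡m⊔n : ∀ m n → m + (n ∸ m) ≡ m ⊔ n
m+[n∸m]≡m⊔n zero    n       = refl
m+[n∸m]≡m⊔n (suc m) zero    = cong suc (+-identityʳ m)
m+[n∸m]≡m⊔n (suc m) (suc n) = cong suc (m+[n∸m]≡m⊔n m n)

eval-max : ∀ {A : Set} {I m} (e : A → Expr) (f : A → ℕ) → (∀ x → ⟦ e x ⟧ I m ≡ f x) →
           ∀ xs → ⟦ maxᴱ (map e xs) ⟧ I m ≡ maximum (map f xs)
eval-max e f eq []       = refl
eval-max e f eq (x ∷ xs) rewrite eq x | eval-max e f eq xs = m+[n∸m]≡m⊔n (f x) _

x∈xs⇒x≤maximum : ∀ {x xs} → x ∈ xs → x ≤ maximum xs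
x∈xs⇒x≤maximum (here refl) = m≤m⊔n _ _
x∈xs⇒x≤maximum (there x∈xs) = ≤-trans (x∈xs⇒x≤maximum x∈xs) (m≤n⊔m _ _)

maximum-attained : ∀ {x xs} → x ∈ xs → maximum xs ∈ xs
maximum-attained {xs = xs} x∈xs with foldr-selective ⊔-sel 0 xs
... | inj₂ max∈xs = max∈xs
-- The fold returned its default 0; then `x ≤ 0`, so `x` itself is the maximum.
... | inj₁ max≡0  = subst (_∈ xs) (trans (n≤0⇒n≡0 (subst (_ ≤_) max≡0 (x∈xs⇒x≤maximum x∈xs))) (sym max≡0)) x∈xs

-- Turns a number computed at run time into an index on which the text of the program may depend.
-- Values out of range fall through to `skip`.
select : ∀ {n} → Expr → (Fin n → Program) → Program
select {zero}  e F = skip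
select {suc n} e F = if e (select (e ⊖ lit 1) (F ∘ suc)) (F zero)

loopFree-select : ∀ {n e} {F : Fin n → Program} → (∀ p → LoopFree (F p)) → LoopFree (select e F)
loopFree-select {zero}  lf = tt
loopFree-select {suc n} lf = loopFree-select (lf ∘ suc) , lf zero

runs-select : ∀ {n I e m o s} {F : Fin n → Program} p → ⟦ e ⟧ I m ≡ toℕ p →
              Runs I (F p) (m , o) s → Runs I (select e F) (m , o) s
runs-select zero    eq (_ , x) = _ , if-no eq x
runs-select (suc p) eq x =
  _ , if-yes (λ eq₀ → case trans (sym eq) eq₀ of λ ())
             (proj₂ (runs-select p (cong (_∸ 1) eq) x))

search : {A : Set} → (A → Expr) → (A → Program) → List A → Program
search g F []       = skip
search g F (x ∷ xs) = if (g x) (search g F xs) (F x)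

loopFree-search : ∀ {A : Set} {g : A → Expr} {F} → (∀ x → LoopFree (F x)) → ∀ xs → LoopFree (search g F xs)
loopFree-search lf []       = tt
loopFree-search lf (x ∷ xs) = loopFree-search lf xs , lf x

-- The given `x` only guarantees that the search succeeds; the element found is the first one with
-- vanishing test and may differ from `x`.
runs-search : ∀ {A : Set} {I m o} {g : A → Expr} {F xs x} → x ∈ xs → ⟦ g x ⟧ I m ≡ 0 →
              ∃[ y ] y ∈ xs × ⟦ g y ⟧ I m ≡ 0 ×
                (∀ {s} → Runs I (F y) (m , o) s → Runs I (search g F xs) (m , o) s)
runs-search {I = I} {m} {g = g} {xs = y ∷ ys} x∈ gx≡0 with ⟦ g y ⟧ I m ≟ 0
... | yes gy≡0 = y , here refl , gy≡0 , λ (_ , r) → _ , if-no gy≡0 r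
runs-search (here refl) gx≡0 | no gy≢0 = contradiction gx≡0 gy≢0
runs-search (there x∈) gx≡0 | no gy≢0 with runs-search x∈ gx≡0
... | z , z∈ , gz≡0 , run = z , there z∈ , gz≡0 , λ r → _ , if-yes gy≢0 (proj₂ (run r))

printAll : List ℕ → Program
printAll []       = skip
printAll (x ∷ xs) = print (lit x) ⨾ printAll xs

loopFree-printAll : ∀ xs → LoopFree (printAll xs)
loopFree-printAll []       = tt
loopFree-printAll (x ∷ xs) = tt , loopFree-printAll xs

runs-printAll : ∀ {I m} o xs → Runs I (printAll xs) (m , o) (m , o ++ xs)
runs-printAll o [] rewrite ++-identityʳ o = _ , skip
runs-printAll o (x ∷ xs) =
  (_ , print) ⨟ subst (λ o′ → Runs _ _ _ (_ , o′)) (++-assoc o [ x ] xs) (runs-printAll (o ∷ʳ x) xs)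

-- Reading the input

-- `bit` and, further on, `block` repeat local functions of `encodeInput`, so that they can be
-- referred to; `encodeInput≡` identifies the two versions.
bit : Bool → ℕ
bit true  = 1
bit false = 0

bits : ∀ {n} → Subset n → List ℕ
bits S = map bit (Vec.toList S)

InputAt : List ℕ → ℕ → List ℕ → Set
InputAt I a []       = ⊤
InputAt I a (x ∷ xs) = at I a ≡ x × InputAt I (suc a) xs

inputAt-∷ : ∀ {I a} y xs → InputAt I a xs → InputAt (y ∷ I) (suc a) xs
inputAt-∷ y []       _          = tt
inputAt-∷ y (x ∷ xs) (eq , eqs) = eq , inputAt-∷ y xs eqs

inputAt-self : ∀ I → InputAt I 0 I
inputAt-self []      = tt
inputAt-self (x ∷ I) = refl , inputAt-∷ x I (inputAt-self I)

inputAt-++ : ∀ {I a} xs {ys} → InputAt I a (xs ++ ys) → InputAt I a xs × InputAt I (length xs + a) ys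
inputAt-++ []       eqs = tt , eqs
inputAt-++ {I} {a} (x ∷ xs) {ys} (eq , eqs) with inputAt-++ xs eqs
... | eqs₁ , eqs₂ = (eq , eqs₁) , subst (λ b → InputAt I b ys) (+-suc (length xs) a) eqs₂

-- A decision tree with one leaf for each subset, so that in `F` the label set is a constant of the
-- program. Its size depends on the alphabet only.
selectBits : ∀ {n} → Expr → (Subset n → Program) → Program
selectBits {zero}  a F = F []
selectBits {suc n} a F = if (inp a) (selectBits (a ⊕ lit 1) (F ∘ (true ∷_)))
                                    (selectBits (a ⊕ lit 1) (F ∘ (false ∷_)))

loopFree-selectBits : ∀ {n a} {F : Subset n → Program} → (∀ S → LoopFree (F S)) → LoopFree (selectBits a F)
loopFree-selectBits {zero}  lf = lf []
loopFree-selectBits {suc n} lf = loopFree-selectBits (lf ∘ (true ∷_)) , loopFree-selectBits (lf ∘ (false ∷_))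

runs-selectBits : ∀ {n I a m o s x} {F : Subset n → Program} (S : Subset n) → ⟦ a ⟧ I m ≡ x →
                  InputAt I x (bits S) → Runs I (F S) (m , o) s → Runs I (selectBits a F) (m , o) s
runs-selectBits []          _    _          r = r
runs-selectBits {m = m} {x = x} (true ∷ S) refl (eq , eqs) r =
  _ , if-yes (λ eq₀ → case trans (sym eq) eq₀ of λ ()) (proj₂ (runs-selectBits S (+-comm x 1) eqs r))
runs-selectBits {x = x} (false ∷ S) refl (eq , eqs) r =
  _ , if-no eq (proj₂ (runs-selectBits S (+-comm x 1) eqs r))

block : ∀ {k T} → Labels k T → Vertex T → List ℕ
block S v = numChildren v ∷ bits (S v)

treeInput : ∀ {k} T → Labels k T → List ℕ
treeInput T S = concatMap (block S) (vertices T)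

encodeInput≡ : ∀ {k T} (S : Labels k T) → encodeInput S ≡ size T ∷ treeInput T S
encodeInput≡ {T = T} S =
  cong (size T ∷_) (concatMap-cong (λ v → cong (numChildren v ∷_)
    (map-cong (λ { true → refl ; false → refl }) (Vec.toList (S v)))) (vertices T))

length-concatMap : ∀ {A B : Set} {c} (f : A → List B) → (∀ x → length (f x) ≡ c) →
                   ∀ xs → length (concatMap f xs) ≡ length xs * c
length-concatMap f eq []       = refl
length-concatMap f eq (x ∷ xs) =
  trans (length-++ (f x)) (cong₂ _+_ (eq x) (length-concatMap f eq xs))

length-block : ∀ {k T} (S : Labels k T) v → length (block S v) ≡ suc k
length-block S v = cong suc (trans (length-map bit (Vec.toList (S v))) (length-toList (S v)))

size-node₁ : ∀ T → size (node₁ T) ≡ suc (size T)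
size-node₁ T = cong suc (length-map below (vertices T))

size-node₂ : ∀ T U → size (node₂ T U) ≡ suc (size T + size U)
size-node₂ T U = cong suc (trans (length-++ (map left (vertices T)))
  (cong₂ _+_ (length-map left (vertices T)) (length-map right (vertices U))))

concatMap-node₁ : ∀ {B : Set} {T} (f : Vertex (node₁ T) → List B) →
  concatMap f (vertices (node₁ T)) ≡ f root ++ concatMap (f ∘ below) (vertices T)
concatMap-node₁ {T = T} f = cong (f root ++_) (concatMap-map f below (vertices T))

concatMap-node₂ : ∀ {B : Set} {T U} (f : Vertex (node₂ T U) → List B) →
  concatMap f (vertices (node₂ T U)) ≡
  f root ++ concatMap (f ∘ left) (vertices T) ++ concatMap (f ∘ right) (vertices U)
concatMap-node₂ {T = T} {U} f = cong (f root ++_) (trans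
  (concatMap-++ f (map left (vertices T)) (map right (vertices U)))
  (cong₂ _++_ (concatMap-map f left (vertices T)) (concatMap-map f right (vertices U))))

-- The input begins with the number of vertices, hence the suc.
blockAddress : ℕ → ℕ → ℕ
blockAddress k i = suc (suc k * i)

blockAddress-+ : ∀ k i n → n * suc k + blockAddress k i ≡ blockAddress k (i + n)
blockAddress-+ k i n = trans (+-suc (n * suc k) (suc k * i)) (cong suc (begin
  n * suc k + suc k * i  ≡⟨ +-comm (n * suc k) (suc k * i) ⟩
  suc k * i + n * suc k  ≡⟨ cong (suc k * i +_) (*-comm n (suc k)) ⟩
  suc k * i + suc k * n  ≡⟨ *-distribˡ-+ (suc k) i n ⟨
  suc k * (i + n)        ∎))
  where open ≡-Reasoning

Reads : ∀ {k} → List ℕ → ℕ → (T : BinaryTree) → Labels k T → Set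
Reads {k} I i T S = InputAt I (blockAddress k i) (treeInput T S)

reads-root : ∀ {k I i} T (S : Labels k T) → Reads I i T S → InputAt I (blockAddress k i) (block S root)
reads-root node₀       S rd = proj₁ (inputAt-++ (block S root) rd)
reads-root (node₁ T)   S rd = proj₁ (inputAt-++ (block S root) rd)
reads-root (node₂ T U) S rd = proj₁ (inputAt-++ (block S root) rd)

inputAt-blocks : ∀ {k I i} (xs : List ℕ) n {ys} → length xs ≡ n * suc k →
                 InputAt I (blockAddress k i) (xs ++ ys) → InputAt I (blockAddress k (i + n)) ys
inputAt-blocks {k} {I} {i} xs n {ys} len r =
  subst (λ a → InputAt I a ys) (trans (cong (_+ _) len) (blockAddress-+ k i n)) (proj₂ (inputAt-++ xs r))

inputAt-below-root : ∀ {k I i T} (S : Labels k T) {ys} → InputAt I (blockAddress k i) (block S root ++ ys) →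
                     InputAt I (blockAddress k (suc i)) ys
inputAt-below-root {k} {I} {i} S {ys} r =
  subst (λ j → InputAt I (blockAddress k j) ys) (+-comm i 1)
        (inputAt-blocks (block S root) 1 (trans (length-block S root) (sym (+-identityʳ _))) r)

reads-node₁ : ∀ {k I i} T (S : Labels k (node₁ T)) → Reads I i (node₁ T) S → Reads I (suc i) T (S ∘ below)
reads-node₁ T S rd = inputAt-below-root S (subst (InputAt _ _) (concatMap-node₁ (block S)) rd)

reads-node₂ : ∀ {k I i} T U (S : Labels k (node₂ T U)) → Reads I i (node₂ T U) S →
              Reads I (suc i) T (S ∘ left) × Reads I (suc i + size T) U (S ∘ right)
reads-node₂ T U S rd
  with inputAt-below-root S (subst (InputAt _ _) (concatMap-node₂ (block S)) rd)
... | rd′ = proj₁ (inputAt-++ (treeInput T (S ∘ left)) rd′)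
          , inputAt-blocks (treeInput T (S ∘ left)) (size T)
              (length-concatMap _ (length-block (S ∘ left)) (vertices T)) rd′

-- Benefits

benefit-node₁ : ∀ {k T} (P : Sequences k (node₁ T)) →
  benefit P ≡ length (P root ∧ P (below root)) + benefit (P ∘ below)
benefit-node₁ {T = T} P = cong (λ xs → length (P root ∧ P (below root)) + sum xs) (sym (map-∘ (edges T)))

benefit-node₂ : ∀ {k T U} (P : Sequences k (node₂ T U)) →
  benefit P ≡ (length (P root ∧ P (left root)) + benefit (P ∘ left)) +
              (length (P root ∧ P (right root)) + benefit (P ∘ right))
benefit-node₂ {T = T} {U} P = begin
  benefit P
    ≡⟨ cong (λ xs → a + (b + sum xs)) (trans (map-++ _ (map _ (edges T)) (map _ (edges U)))
         (cong₂ _++_ (sym (map-∘ (edges T))) (sym (map-∘ (edges U))))) ⟩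
  a + (b + sum (map _ (edges T) ++ map _ (edges U)))
    ≡⟨ cong (λ x → a + (b + x)) (sum-++ (map _ (edges T)) (map _ (edges U))) ⟩
  a + (b + (benefit (P ∘ left) + benefit (P ∘ right)))
    ≡⟨ cong (a +_) (x∙yz≈y∙xz b (benefit (P ∘ left)) (benefit (P ∘ right))) ⟩
  a + (benefit (P ∘ left) + (b + benefit (P ∘ right)))
    ≡⟨ +-assoc a _ _ ⟨
  (a + benefit (P ∘ left)) + (b + benefit (P ∘ right)) ∎
  where
  open ≡-Reasoning
  open CommSemigroupProperties +-commutativeSemigroup using (x∙yz≈y∙xz)
  a = length (P root ∧ P (left root))
  b = length (P root ∧ P (right root))

-- The recurrence of the dynamic program and its memory layout.

module TreeProgram {k N : ℕ} (word : Fin N → List (Fin k)) (empty : Fin N)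
                   (perms : Subset k → List (Fin N)) where

  -- up T S u is the optimal benefit of T plus that of an edge to an extra
  -- parent of its root whose sequence is u; down T S w is the optimal benefit
  -- of T when the root has the sequence w.
  mutual
    up : ∀ T → Labels k T → List (Fin k) → ℕ
    up T S u = maximum (map (λ j → length (u ∧ word j) + down T S (word j)) (perms (S root)))

    down : ∀ T → Labels k T → List (Fin k) → ℕ
    down node₀       S w = 0
    down (node₁ T)   S w = up T (S ∘ below) w
    down (node₂ T U) S w = up T (S ∘ left) w + up U (S ∘ right) w

  -- Memory layout: cell 0 holds the number of the current vertex, and every
  -- vertex has a block of cells: the index of the word chosen at its parent, the
  -- number of the first vertex after its subtree, and the values of up.
  Field : Set
  Field = Fin (2 + N)

  pattern parent = zero
  pattern next   = suc zero
  pattern gain j = suc (suc j)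

  idx : Expr
  idx = mem (lit 0)

  opaque
    -- The leading `suc` keeps cell 0 free for the current vertex. Outside the opaque block only
    -- disjointness and evaluation of addresses are used, never the arithmetic.
    cell : ℕ → Field → ℕ
    cell i f = suc (toℕ f + i * (2 + N))

    cell≢0 : ∀ {i f} → 0 ≢ cell i f
    cell≢0 ()

    -- A field is smaller than the stride `2 + N`, so the remainder modulo the stride recovers it,
    -- and cancellation then recovers the vertex.
    cell-injective : ∀ {i j f g} → cell i f ≡ cell j g → i ≡ j × f ≡ g
    cell-injective {i} {j} {f} {g} eq =
      *-cancelʳ-≡ i j (2 + N) (+-cancelˡ-≡ (toℕ f) _ _
        (trans eq′ (cong (λ h → toℕ h + j * (2 + N)) (sym f≡g)))) , f≡g
      where
      eq′ : toℕ f + i * (2 + N) ≡ toℕ g + j * (2 + N)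
      eq′ = suc-injective eq
      remainder : ∀ i (f : Field) → (toℕ f + i * (2 + N)) % (2 + N) ≡ toℕ f
      remainder i f = trans ([m+kn]%n≡m%n (toℕ f) i (2 + N)) (m<n⇒m%n≡m (toℕ<n f))
      f≡g : f ≡ g
      f≡g = toℕ-injective (trans (sym (remainder i f)) (trans (cong (_% (2 + N)) eq′) (remainder j g)))

    cellᴱ : Expr → Field → Expr
    cellᴱ e f = lit (suc (toℕ f)) ⊕ times (2 + N) e

    eval-cell : ∀ I m {i} e f → ⟦ e ⟧ I m ≡ i → ⟦ cellᴱ e f ⟧ I m ≡ cell i f
    eval-cell I m {i} e f refl =
      cong (suc (toℕ f) +_) (trans (eval-times (2 + N) e I m) (*-comm (2 + N) i))

    blockᴱ : Expr
    blockᴱ = lit 1 ⊕ times (suc k) idx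

    eval-block : ∀ I m {i} → m 0 ≡ i → ⟦ blockᴱ ⟧ I m ≡ blockAddress k i
    eval-block I m m0≡i = cong suc (trans (eval-times (suc k) idx I m) (cong (suc k *_) m0≡i))

  -- The value of `parent` is a dummy. It survives only at the root of the whole tree, where it
  -- plays the word of a fictitious parent; every other vertex gets its value in the second pass.
  content : ℕ → ∀ T → Labels k T → Field → ℕ
  content i T S parent   = toℕ empty
  content i T S next     = i + size T
  content i T S (gain j) = up T S (word j)

  -- Memory invariants for the stored tables.

  mutual
    -- Only fields of the form `suc f` are constrained: `parent` is left out because the second pass
    -- overwrites it.
    Table : Memory → ℕ → ∀ T → Labels k T → Set
    Table m i T S = (∀ f → m (cell i (suc f)) ≡ content i T S (suc f)) × SubTables m i T S

    SubTables : Memory → ℕ → ∀ T → Labels k T → Set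
    SubTables m i node₀       S = ⊤
    SubTables m i (node₁ T)   S = Table m (suc i) T (S ∘ below)
    SubTables m i (node₂ T U) S = Table m (suc i) T (S ∘ left) × Table m (suc i + size T) U (S ∘ right)

  AgreeFrom : ℕ → Memory → Memory → Set
  AgreeFrom i m m′ = ∀ j f → i ≤ j → m′ (cell j (suc f)) ≡ m (cell j (suc f))

  agree-mono : ∀ {i j} m m′ → i ≤ j → AgreeFrom i m m′ → AgreeFrom j m m′
  agree-mono m m′ i≤j ag l f j≤l = ag l f (≤-trans i≤j j≤l)

  mutual
    -- In preorder the subtree rooted at vertex `i` has no vertex numbered below `i`, so agreement
    -- from `i` on suffices.
    table-resp : ∀ {m m′ i} T S → AgreeFrom i m m′ → Table m i T S → Table m′ i T S
    table-resp {m} {m′} T S ag (own , subs) =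
      (λ f → trans (ag _ f ≤-refl) (own f)) , subTables-resp T S (agree-mono m m′ (n≤1+n _) ag) subs

    subTables-resp : ∀ {m m′ i} T S → AgreeFrom (suc i) m m′ → SubTables m i T S → SubTables m′ i T S
    subTables-resp node₀       S ag _       = tt
    subTables-resp (node₁ T)   S ag t       = table-resp T _ ag t
    subTables-resp {m} {m′} (node₂ T U) S ag (t , u) =
      table-resp T _ ag t , table-resp U _ (agree-mono m m′ (m≤m+n _ (size T)) ag) u

  -- Machine expressions for the recurrence.

  -- The number of the c-th child of the current vertex; for c the number of
  -- children, that of the first vertex after the subtree.
  position : ℕ → Expr
  position zero    = idx ⊕ lit 1
  position (suc c) = mem (cellᴱ (position c) next)

  -- With `c` the number of children, this is the machine counterpart of `down`.
  received : ℕ → Fin N → Expr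
  received zero    j = lit 0
  received (suc c) j = received c j ⊕ mem (cellᴱ (position c) (gain j))

  candidate : ℕ → List (Fin k) → Fin N → Expr
  candidate c u j = lit (length (u ∧ word j)) ⊕ received c j

  fieldᴱ : ℕ → Subset k → Field → Expr
  fieldᴱ c S parent   = lit (toℕ empty)
  fieldᴱ c S next     = position c
  fieldᴱ c S (gain p) = maxᴱ (map (candidate c (word p)) (perms S))

  arity : BinaryTree → ℕ
  arity T = numChildren (root {T})

  eval-mem-cell : ∀ I m {i} e f → ⟦ e ⟧ I m ≡ i → ⟦ mem (cellᴱ e f) ⟧ I m ≡ m (cell i f)
  eval-mem-cell I m e f eq = cong m (eval-cell I m e f eq)

  eval-position₀ : ∀ I m {i} → m 0 ≡ i → ⟦ position 0 ⟧ I m ≡ suc i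
  eval-position₀ I m {i = i} refl = +-comm i 1

  eval-position-suc : ∀ I m {i T S} c → ⟦ position c ⟧ I m ≡ i → Table m i T S →
                      ⟦ position (suc c) ⟧ I m ≡ i + size T
  eval-position-suc I m c eq (own , _) = trans (eval-mem-cell I m (position c) next eq) (own zero)

  eval-gain : ∀ I m {i T S} e j → ⟦ e ⟧ I m ≡ i → Table m i T S →
              ⟦ mem (cellᴱ e (gain j)) ⟧ I m ≡ up T S (word j)
  eval-gain I m e j eq (own , _) = trans (eval-mem-cell I m e (gain j) eq) (own (suc j))

  end-node₁ : ∀ i T → suc i + size T ≡ i + size (node₁ T)
  end-node₁ i T = trans (sym (+-suc i (size T))) (cong (i +_) (sym (size-node₁ T)))

  end-node₂ : ∀ i T U → suc i + size T + size U ≡ i + size (node₂ T U)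
  end-node₂ i T U = trans (+-assoc (suc i) (size T) (size U))
    (trans (sym (+-suc i _)) (cong (i +_) (sym (size-node₂ T U))))

  -- The subtree of a child starts where that of the preceding child ends, so the `next` pointers of
  -- the children lead to the end of the whole subtree.
  eval-end : ∀ I m {i} T S → m 0 ≡ i → SubTables m i T S → ⟦ position (arity T) ⟧ I m ≡ i + size T
  eval-end I m {i} node₀ S eq _ = trans (eval-position₀ I m eq) (+-comm 1 i)
  eval-end I m {i} (node₁ T) S eq t =
    trans (eval-position-suc I m 0 (eval-position₀ I m eq) t) (end-node₁ i T)
  eval-end I m {i} (node₂ T U) S eq (t , u) =
    trans (eval-position-suc I m 1 (eval-position-suc I m 0 (eval-position₀ I m eq) t) u)
          (end-node₂ i T U)

  eval-received : ∀ I m {i} T S → m 0 ≡ i → SubTables m i T S → ∀ j →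
                  ⟦ received (arity T) j ⟧ I m ≡ down T S (word j)
  eval-received I m node₀       S eq _       j = refl
  eval-received I m (node₁ T)   S eq t       j = eval-gain I m (position 0) j (eval-position₀ I m eq) t
  eval-received I m (node₂ T U) S eq (t , u) j = cong₂ _+_
    (eval-gain I m (position 0) j (eval-position₀ I m eq) t)
    (eval-gain I m (position 1) j (eval-position-suc I m 0 (eval-position₀ I m eq) t) u)

  eval-candidate : ∀ I m {i} T S → m 0 ≡ i → SubTables m i T S → ∀ u j →
                   ⟦ candidate (arity T) u j ⟧ I m ≡ length (u ∧ word j) + down T S (word j)
  eval-candidate I m T S eq subs u j = cong (length (u ∧ word j) +_) (eval-received I m T S eq subs j)

  eval-field : ∀ I m {i} T S → m 0 ≡ i → SubTables m i T S → ∀ f →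
               ⟦ fieldᴱ (arity T) (S root) f ⟧ I m ≡ content i T S f
  eval-field I m T S eq subs parent   = refl
  eval-field I m T S eq subs next     = eval-end I m T S eq subs
  eval-field I m T S eq subs (gain p) =
    eval-max _ _ (eval-candidate I m T S eq subs (word p)) (perms (S root))

  -- Branching on the input block of the current vertex.

  dispatch : (ℕ → Subset k → Program) → Program
  dispatch F = selectBits (blockᴱ ⊕ lit 1) λ S →
    if (inp blockᴱ) (if (inp blockᴱ ⊖ lit 1) (F 2 S) (F 1 S)) (F 0 S)

  loopFree-dispatch : ∀ F → (∀ c S → LoopFree (F c S)) → LoopFree (dispatch F)
  loopFree-dispatch F lf = loopFree-selectBits λ S → (lf 2 S , lf 1 S) , lf 0 S

  runs-dispatch : ∀ {I m o i s} F T S → m 0 ≡ i → Reads I i T S →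
                  Runs I (F (arity T) (S root)) (m , o) s → Runs I (dispatch F) (m , o) s
  runs-dispatch {I} {m} {o} {i} {s} F T S m0≡i rd r =
    runs-selectBits (S root) (trans (cong (_+ 1) blk) (+-comm _ 1)) (proj₂ blockAt) (branch T (S root) r here≡)
    where
    blockAt = reads-root T S rd
    blk = eval-block I m m0≡i
    here≡ : ⟦ inp blockᴱ ⟧ I m ≡ arity T
    here≡ = trans (cong (at I) blk) (proj₁ blockAt)
    -- The label set is generalised to `R`, so that the case split on the tree leaves `S` alone.
    branch : ∀ T R → Runs I (F (arity T) R) (m , o) s → ⟦ inp blockᴱ ⟧ I m ≡ arity T →
             Runs I (if (inp blockᴱ) (if (inp blockᴱ ⊖ lit 1) (F 2 R) (F 1 R)) (F 0 R)) (m , o) s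
    branch node₀       R (_ , x) eq = _ , if-no eq x
    branch (node₁ T)   R (_ , x) eq = _ , if-yes (λ eq₀ → case trans (sym eq) eq₀ of λ ())
                                           (if-no (cong (_∸ 1) eq) x)
    branch (node₂ T U) R (_ , x) eq = _ , if-yes (λ eq₀ → case trans (sym eq) eq₀ of λ ())
      (if-yes (λ eq₁ → case trans (sym (cong (_∸ 1) eq)) eq₁ of λ ()) x)

  -- First pass: computing the tables in reverse preorder.

  fill : (Field → Expr) → List Field → Program
  fill e []       = skip
  fill e (f ∷ fs) = store (cellᴱ idx f) (e f) ⨾ fill e fs

  loopFree-fill : ∀ {e} fs → LoopFree (fill e fs)
  loopFree-fill []       = tt
  loopFree-fill (f ∷ fs) = tt , loopFree-fill fs

  update-cell : ∀ m {i j f g} x → ¬ (j ≡ i × g ≡ f) → (m [ cell i f ≔ x ]) (cell j g) ≡ m (cell j g)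
  update-cell m x ≢ = update-other m x (≢ ∘ cell-injective)

  -- The disjunction in the last clause carries the induction: a field written earlier stays correct
  -- while the remaining ones are written. Tables of descendants survive because their vertices have
  -- larger numbers.
  runs-fill : ∀ {I i m o} T S fs → m 0 ≡ i → SubTables m i T S →
    ∃[ m′ ] Runs I (fill (fieldᴱ (arity T) (S root)) fs) (m , o) (m′ , o)
          × m′ 0 ≡ i
          × (∀ j f → j ≢ i → m′ (cell j f) ≡ m (cell j f))
          × (∀ f → f ∈ fs ⊎ m (cell i f) ≡ content i T S f → m′ (cell i f) ≡ content i T S f)
  runs-fill {m = m} T S [] m0≡i subs = m , (_ , skip) , m0≡i , (λ _ _ _ → refl) , λ { _ (inj₂ eq) → eq }
  runs-fill {I} {i} {m} {o} T S (f ∷ fs) m0≡i subs =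
    let m′ , run , m′0≡i , outside , inside = runs-fill T S fs m₁0≡i subs₁
    in m′ , (first ⨟ run) , m′0≡i
       , (λ j g j≢i → trans (outside j g j≢i) (other j g (j≢i ∘ proj₁)))
       , λ g h → inside g (written g h)
    where
    m₁ = m [ cell i f ≔ content i T S f ]
    other : ∀ j g → ¬ (j ≡ i × g ≡ f) → m₁ (cell j g) ≡ m (cell j g)
    other j g = update-cell m (content i T S f)
    m₁0≡i : m₁ 0 ≡ i
    m₁0≡i = trans (update-other m (content i T S f) cell≢0) m0≡i
    subs₁ : SubTables m₁ i T S
    subs₁ = subTables-resp T S (λ j g i<j → other j (suc g) (λ (j≡i , _) → <⇒≢ i<j (sym j≡i))) subs
    first : Runs I (store (cellᴱ idx f) (fieldᴱ (arity T) (S root) f)) (m , o) (m₁ , o)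
    first = runs-store (eval-cell I m idx f m0≡i) (eval-field I m T S m0≡i subs f)
    written : ∀ g → g ∈ f ∷ fs ⊎ m (cell i g) ≡ content i T S g →
              g ∈ fs ⊎ m₁ (cell i g) ≡ content i T S g
    written g h with g Fin.≟ f
    written g h                   | yes refl = inj₂ (update-same m (cell i f) _)
    written g (inj₁ (here g≡f))   | no g≢f = contradiction g≡f g≢f
    written g (inj₁ (there g∈fs)) | no _   = inj₁ g∈fs
    written g (inj₂ eq)           | no g≢f = inj₂ (trans (other i g (g≢f ∘ proj₂)) eq)

  fillAll : ℕ → Subset k → Program
  fillAll c S = fill (fieldᴱ c S) (allFin _)

  -- The decrement comes first: cell 0 starts at the number of vertices, and the guard, tested
  -- before the decrement, admits exactly the rounds for the vertices down to 0.
  collectBody : Program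
  collectBody = store (lit 0) (idx ⊖ lit 1) ⨾ dispatch fillAll

  loopFree-collectBody : LoopFree collectBody
  loopFree-collectBody = tt , loopFree-dispatch fillAll (λ _ _ → loopFree-fill (allFin _))

  collect-root : ∀ {I i m o} T S → Reads I i T S → m 0 ≡ suc i → SubTables m i T S →
    ∃[ m′ ] Iterations I idx collectBody 1 (m , o) (m′ , o)
          × m′ 0 ≡ i × Table m′ i T S × m′ (cell i parent) ≡ toℕ empty
          × (∀ j f → suc i ≤ j → m′ (cell j f) ≡ m (cell j f))
  collect-root {I} {i} {m} {o} T S rd eq subs =
    let m′ , run , m′0≡i , outside , inside =
          runs-fill T S (allFin _) (update-same m 0 i) (subTables-resp T S (λ j f _ → unmoved j (suc f)) subs)
        above j f i<j = trans (outside j f (λ j≡i → <⇒≢ i<j (sym j≡i))) (unmoved j f)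
    in m′
       , step (λ eq₀ → case trans (sym eq) eq₀ of λ ())
              (runs-store refl (cong (_∸ 1) eq) ⨟ runs-dispatch fillAll T S (update-same m 0 i) rd run) []
       , m′0≡i
       , ((λ f → inside (suc f) (inj₁ (∈-allFin _))) , subTables-resp T S (λ j f → above j (suc f)) subs)
       , inside parent (inj₁ (∈-allFin _))
       , above
    where
    unmoved : ∀ j f → (m [ 0 ≔ i ]) (cell j f) ≡ m (cell j f)
    unmoved j f = update-other m i (cell≢0 ∘ sym)

  -- Right subtree, left subtree, root. The frame condition on vertices after the subtree keeps the
  -- finished right tables intact while the left subtree is processed.
  collect : ∀ {I i m o} T S → Reads I i T S → m 0 ≡ i + size T →
    ∃[ m′ ] Iterations I idx collectBody (size T) (m , o) (m′ , o)
          × m′ 0 ≡ i × Table m′ i T S × m′ (cell i parent) ≡ toℕ empty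
          × (∀ j f → i + size T ≤ j → m′ (cell j f) ≡ m (cell j f))
  collect {i = i} node₀ S rd eq =
    let m′ , iter , eq′ , table , parent≡ , frame = collect-root node₀ S rd (trans eq (+-comm i 1)) tt
    in m′ , iter , eq′ , table , parent≡ , λ j f le → frame j f (≤-trans (≤-reflexive (+-comm 1 i)) le)
  collect {i = i} {m} (node₁ T) S rd eq =
    let m₁ , iter₁ , eq₁ , table₁ , _ , frame₁ =
          collect {m = m} T _ (reads-node₁ T S rd) (trans eq (sym (end-node₁ i T)))
        m′ , iter , eq′ , table , parent≡ , frame = collect-root (node₁ T) S rd eq₁ table₁
    in m′ , castᴵ (trans (+-comm (size T) 1) (sym (size-node₁ T))) refl (iter₁ ++ᴵ iter)
       , eq′ , table , parent≡
       , λ j f le →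
           let le₁ = ≤-trans (≤-reflexive (end-node₁ i T)) le
           in trans (frame j f (≤-trans (m≤m+n (suc i) _) le₁)) (frame₁ j f le₁)
  collect {i = i} {m} (node₂ T U) S rd eq =
    let rdT , rdU = reads-node₂ T U S rd
        m₁ , iter₁ , eq₁ , table₁ , _ , frame₁ =
          collect {m = m} U _ rdU (trans eq (sym (end-node₂ i T U)))
        m₂ , iter₂ , eq₂ , table₂ , _ , frame₂ = collect T _ rdT eq₁
        m′ , iter , eq′ , table , parent≡ , frame =
          collect-root (node₂ T U) S rd eq₂ (table₂ , table-resp U _ (λ j f → frame₂ j (suc f)) table₁)
    in m′ , castᴵ (trans count (sym (size-node₂ T U))) refl (iter₁ ++ᴵ iter₂ ++ᴵ iter)
       , eq′ , table , parent≡
       , λ j f le →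
           let le₁ = ≤-trans (≤-reflexive (end-node₂ i T U)) le
               le₂ = ≤-trans (m≤m+n (suc i + size T) (size U)) le₁
           in trans (frame j f (≤-trans (m≤m+n (suc i) (size T)) le₂))
                (trans (frame₂ j f le₂) (frame₁ j f le₁))
    where
    count : size U + (size T + 1) ≡ suc (size T + size U)
    count = trans (cong (size U +_) (+-comm (size T) 1))
                  (trans (+-suc (size U) (size T)) (cong suc (+-comm (size U) (size T))))

  -- Second pass: choosing and printing words in preorder.

  entry : List (Fin k) → List ℕ
  entry w = length w ∷ map toℕ w

  notify : ℕ → Fin N → Program
  notify zero    j = skip
  notify (suc c) j = notify c j ⨾ store (cellᴱ (position c) parent) (lit (toℕ j))

  loopFree-notify : ∀ c j → LoopFree (notify c j)
  loopFree-notify zero    j = tt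
  loopFree-notify (suc c) j = loopFree-notify c j , tt

  announce : ℕ → Fin N → Program
  announce c j = printAll (entry (word j)) ⨾ notify c j

  -- The stored gain is the maximum of the candidates, so the truncated
  -- difference vanishes exactly at the candidates attaining it.
  loss : ℕ → Fin N → Fin N → Expr
  loss c p j = mem (cellᴱ idx (gain p)) ⊖ candidate c (word p) j

  choose : ℕ → Subset k → Program
  choose c S = select (mem (cellᴱ idx parent)) λ p → search (loss c p) (announce c) (perms S)

  -- Input cell 0 holds the number of vertices, so the difference is nonzero exactly while the
  -- current vertex exists.
  guard : Expr
  guard = inp (lit 0) ⊖ idx

  distributeBody : Program
  distributeBody = dispatch choose ⨾ store (lit 0) (idx ⊕ lit 1)

  loopFree-distributeBody : LoopFree distributeBody
  loopFree-distributeBody =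
    loopFree-dispatch choose (λ c S → loopFree-select λ p →
      loopFree-search (λ j → loopFree-printAll (entry (word j)) , loopFree-notify c j) (perms S)) , tt

  SameTables : Memory → Memory → Set
  SameTables m m′ = ∀ j f → m′ (cell j (suc f)) ≡ m (cell j (suc f))

  SameParentsFrom : ℕ → Memory → Memory → Set
  SameParentsFrom n m m′ = ∀ j → n ≤ j → m′ (cell j parent) ≡ m (cell j parent)

  Notified : Memory → ℕ → BinaryTree → Fin N → Set
  Notified m i node₀       j = ⊤
  Notified m i (node₁ T)   j = m (cell (suc i) parent) ≡ toℕ j
  Notified m i (node₂ T U) j = m (cell (suc i) parent) ≡ toℕ j × m (cell (suc i + size T) parent) ≡ toℕ j

  size>0 : ∀ T → 0 < size T
  size>0 node₀       = s≤s z≤n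
  size>0 (node₁ T)   = s≤s z≤n
  size>0 (node₂ T U) = s≤s z≤n

  m<m+size : ∀ m T → m < m + size T
  m<m+size m T = m<m+n m (size>0 T)

  parent≢suc : ∀ {i j : ℕ} {f : Fin (suc N)} → ¬ (j ≡ i × suc f ≡ parent)
  parent≢suc (_ , ())

  -- Only `parent` cells are written, so the `next` pointer that locates the second child is still
  -- valid after the first store. Both children lie before the end of the subtree.
  runs-notify : ∀ {I i m o} T S j → m 0 ≡ i → SubTables m i T S →
    ∃[ m′ ] Runs I (notify (arity T) j) (m , o) (m′ , o)
          × m′ 0 ≡ i × Notified m′ i T j × SameTables m m′ × SameParentsFrom (i + size T) m m′
  runs-notify {m = m} node₀ S j m0≡i _ =
    m , (_ , skip) , m0≡i , tt , (λ _ _ → refl) , (λ _ _ → refl)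
  runs-notify {I} {i} {m} (node₁ T) S j m0≡i t =
    m [ cell (suc i) parent ≔ toℕ j ]
    , ((_ , skip) ⨟ runs-store (eval-cell I m (position 0) parent (eval-position₀ I m m0≡i)) refl)
    , trans (update-other m _ cell≢0) m0≡i
    , update-same m (cell (suc i) parent) _
    , (λ l f → update-cell m _ parent≢suc)
    , (λ l le → update-cell m _ λ (l≡ , _) →
        <⇒≢ (≤-trans (m<m+size (suc i) T) (≤-trans (≤-reflexive (end-node₁ i T)) le)) (sym l≡))
  runs-notify {I} {i} {m} (node₂ T U) S j m0≡i (t , u) =
    m₂
    , (((_ , skip) ⨟ runs-store (eval-cell I m (position 0) parent (eval-position₀ I m m0≡i)) refl)
       ⨟ runs-store (eval-cell I m₁ (position 1) parent
           (eval-position-suc I m₁ 0 (eval-position₀ I m₁ m₁0≡i) t₁)) refl)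
    , trans (update-other m₁ _ cell≢0) m₁0≡i
    , (trans (update-cell m₁ _ (λ (eq , _) → <⇒≢ (m<m+size (suc i) T) eq)) (update-same m (cell (suc i) parent) _)
      , update-same m₁ (cell (suc i + size T) parent) _)
    , (λ l f → trans (update-cell m₁ _ parent≢suc) (update-cell m _ parent≢suc))
    , (λ l le →
        let le′ = ≤-trans (≤-reflexive (end-node₂ i T U)) le
            lt  = ≤-trans (m<m+size (suc i + size T) U) le′
        in trans (update-cell m₁ _ λ (l≡ , _) → <⇒≢ lt (sym l≡))
                 (update-cell m _ λ (l≡ , _) → <⇒≢ (≤-<-trans (m≤m+n (suc i) (size T)) lt) (sym l≡)))
    where
    m₁ = m [ cell (suc i) parent ≔ toℕ j ]
    m₂ = m₁ [ cell (suc i + size T) parent ≔ toℕ j ]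
    m₁0≡i : m₁ 0 ≡ i
    m₁0≡i = trans (update-other m _ cell≢0) m0≡i
    t₁ : Table m₁ (suc i) T (S ∘ left)
    t₁ = table-resp T _ (λ l f _ → update-cell m _ parent≢suc) t

  -- `sound` makes the output feasible, `complete` shows that no solution beats `up`, and `nonempty`
  -- ensures that the maxima are attained.
  module Correctness
    (sound    : ∀ S {j} → j ∈ perms S → IsPermutationOf S (word j))
    (complete : ∀ S {w} → IsPermutationOf S w → ∃[ j ] j ∈ perms S × word j ≡ w)
    (nonempty : ∀ S → ∃[ j ] j ∈ perms S)
    where

    -- Once the word at a vertex is fixed, the subtrees of its children contribute independently,
    -- each together with its edge to that vertex.
    benefit≤up : ∀ T (S : Labels k T) (Q : Sequences k T) → IsSolution S Q →
                 ∀ u → length (u ∧ Q root) + benefit Q ≤ up T S u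
    benefit≤down : ∀ T (S : Labels k T) (Q : Sequences k T) → IsSolution S Q →
                   benefit Q ≤ down T S (Q root)

    benefit≤up T S Q sol u with complete (S root) (sol root)
    ... | j , j∈ , eq = begin
      length (u ∧ Q root) + benefit Q              ≤⟨ +-monoʳ-≤ _ (benefit≤down T S Q sol) ⟩
      length (u ∧ Q root) + down T S (Q root)      ≡⟨ cong (λ w → length (u ∧ w) + down T S w) eq ⟨
      length (u ∧ word j) + down T S (word j)      ≤⟨ x∈xs⇒x≤maximum (∈-map⁺ _ j∈) ⟩
      up T S u                                     ∎
      where open ≤-Reasoning

    benefit≤down node₀       S Q sol = z≤n
    benefit≤down (node₁ T)   S Q sol =
      ≤-trans (≤-reflexive (benefit-node₁ Q)) (benefit≤up T _ (Q ∘ below) (sol ∘ below) (Q root))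
    benefit≤down (node₂ T U) S Q sol =
      ≤-trans (≤-reflexive (benefit-node₂ Q))
        (+-mono-≤ (benefit≤up T _ (Q ∘ left) (sol ∘ left) (Q root))
                  (benefit≤up U _ (Q ∘ right) (sol ∘ right) (Q root)))

    up-attained : ∀ T S u → ∃[ j ] j ∈ perms (S root) × up T S u ≡ length (u ∧ word j) + down T S (word j)
    up-attained T S u = ∈-map⁻ _ (maximum-attained (∈-map⁺ _ (proj₂ (nonempty (S root)))))

    -- Some candidate attains the stored maximum, so the search stops. Wherever it stops, zero loss
    -- gives one inequality and membership among the candidates the other.
    distribute-root : ∀ {I i m o} T S p → Reads I i T S → m 0 ≡ i → Table m i T S →
      m (cell i parent) ≡ toℕ p → i < at I 0 →
      ∃[ j ] j ∈ perms (S root)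
           × length (word p ∧ word j) + down T S (word j) ≡ up T S (word p)
           × ∃[ m′ ] Iterations I guard distributeBody 1 (m , o) (m′ , o ++ entry (word j))
                   × m′ 0 ≡ suc i × Notified m′ i T j × SameTables m m′ × SameParentsFrom (i + size T) m m′
    distribute-root {I} {i} {m} {o} T S p rd m0≡i (own , subs) m[i]≡p i<n =
      let x , x∈ , up≡       = up-attained T S (word p)
          j , j∈ , gj≡0 , run = runs-search {I = I} {m} {o} {loss (arity T) p} {announce (arity T)}
            x∈ (trans (eval-loss x) (m≤n⇒m∸n≡0 (≤-reflexive up≡)))
          m′ , run′ , m′0≡i , notified , same , parents = runs-notify T S j m0≡i subs
      in j , j∈
         , ≤-antisym (x∈xs⇒x≤maximum (∈-map⁺ _ j∈)) (m∸n≡0⇒m≤n (trans (sym (eval-loss j)) gj≡0))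
         , m′ [ 0 ≔ suc i ]
         , step (λ eq → m>n⇒m∸n≢0 i<n (trans (cong (at I 0 ∸_) (sym m0≡i)) eq))
             (runs-dispatch choose T S m0≡i rd
               (runs-select p (trans (eval-mem-cell I m idx parent m0≡i) m[i]≡p)
                 (run (runs-printAll o (entry (word j)) ⨟ run′)))
              ⨟ runs-store refl (trans (cong (_+ 1) m′0≡i) (+-comm i 1))) []
         , update-same m′ 0 (suc i)
         , notified-resp T notified
         , (λ l f → trans (unmoved m′ l (suc f)) (same l f))
         , (λ l le → trans (unmoved m′ l parent) (parents l le))
      where
      eval-loss : ∀ j → ⟦ loss (arity T) p j ⟧ I m ≡
                  up T S (word p) ∸ (length (word p ∧ word j) + down T S (word j))
      eval-loss j = cong₂ _∸_ (trans (eval-mem-cell I m idx (gain p) m0≡i) (own (suc p)))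
                              (eval-candidate I m T S m0≡i subs (word p) j)
      unmoved : ∀ m j f → (m [ 0 ≔ suc i ]) (cell j f) ≡ m (cell j f)
      unmoved m j f = update-other m (suc i) (cell≢0 ∘ sym)
      notified-resp : ∀ {m j} T → Notified m i T j → Notified (m [ 0 ≔ suc i ]) i T j
      notified-resp node₀       _       = tt
      notified-resp {m} (node₁ T)   a       = trans (unmoved m _ _) a
      notified-resp {m} (node₂ T U) (a , b) = trans (unmoved m _ _) a , trans (unmoved m _ _) b

    -- While the left subtree is processed, the right one must keep its tables and the word
    -- announced to its root; `SameTables` and `SameParentsFrom` carry this through the recursion.
    distribute : ∀ {I i m o} T (S : Labels k T) p → Reads I i T S → m 0 ≡ i → Table m i T S →
      m (cell i parent) ≡ toℕ p → i + size T ≤ at I 0 →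
      ∃[ m′ ] Σ[ P ∈ Sequences k T ]
          IsSolution S P
        × length (word p ∧ P root) + benefit P ≡ up T S (word p)
        × Iterations I guard distributeBody (size T) (m , o) (m′ , o ++ encodeOutput P)
        × m′ 0 ≡ i + size T × SameTables m m′ × SameParentsFrom (i + size T) m m′
    distribute {I} {i} {m} {o} node₀ S p rd m0≡i table m[i]≡p i+1≤n =
      let j , j∈ , opt , m′ , iter , m′0≡ , _ , same , parents =
            distribute-root {o = o} node₀ S p rd m0≡i table m[i]≡p (≤-trans (≤-reflexive (+-comm 1 i)) i+1≤n)
      in m′ , (λ _ → word j) , (λ { root → sound (S root) j∈ }) , opt
         , castᴵ refl (cong (o ++_) (sym (++-identityʳ (entry (word j))))) iter
         , trans m′0≡ (+-comm 1 i) , same , parents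
    distribute {I} {i} {m} {o} (node₁ T) S p rd m0≡i table m[i]≡p end≤n =
      let j , j∈ , opt , m₁ , iter₁ , m₁0≡ , notified , same₁ , parents₁ =
            distribute-root {o = o} (node₁ T) S p rd m0≡i table m[i]≡p
              (≤-trans (m<m+size i (node₁ T)) end≤n)
          m₂ , P₂ , sol₂ , opt₂ , iter₂ , m₂0≡ , same₂ , parents₂ =
            distribute {o = o ++ entry (word j)} T _ j (reads-node₁ T S rd) m₁0≡
              (table-resp T _ (λ l f _ → same₁ l f) (proj₂ table)) notified
              (≤-trans (≤-reflexive (end-node₁ i T)) end≤n)
          P : Sequences k (node₁ T)
          P = λ { root → word j ; (below v) → P₂ v }
      in m₂ , P
         , (λ { root → sound (S root) j∈ ; (below v) → sol₂ v })
         , trans (cong (length (word p ∧ word j) +_) (trans (benefit-node₁ P) opt₂)) opt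
         , castᴵ (sym (size-node₁ T))
             (trans (++-assoc o _ _) (cong (o ++_) (sym (concatMap-node₁ (entry ∘ P))))) (iter₁ ++ᴵ iter₂)
         , trans m₂0≡ (end-node₁ i T)
         , (λ l f → trans (same₂ l f) (same₁ l f))
         , (λ l le → trans (parents₂ l (≤-trans (≤-reflexive (end-node₁ i T)) le)) (parents₁ l le))
    distribute {I} {i} {m} {o} (node₂ T U) S p rd m0≡i table m[i]≡p end≤n =
      let j , j∈ , opt , m₁ , iter₁ , m₁0≡ , (notifiedT , notifiedU) , same₁ , parents₁ =
            distribute-root {o = o} (node₂ T U) S p rd m0≡i table m[i]≡p
              (≤-trans (m<m+size i (node₂ T U)) end≤n)
          rdT , rdU = reads-node₂ T U S rd
          _ , tableT , tableU = table
          end≤n′ = ≤-trans (≤-reflexive (end-node₂ i T U)) end≤n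
          m₂ , P₂ , sol₂ , opt₂ , iter₂ , m₂0≡ , same₂ , parents₂ =
            distribute {o = o ++ entry (word j)} T _ j rdT m₁0≡
              (table-resp T _ (λ l f _ → same₁ l f) tableT) notifiedT
              (≤-trans (m≤m+n _ (size U)) end≤n′)
          m₃ , P₃ , sol₃ , opt₃ , iter₃ , m₃0≡ , same₃ , parents₃ =
            distribute {o = (o ++ entry (word j)) ++ encodeOutput P₂} U _ j rdU m₂0≡
              (table-resp U _ (λ l f _ → trans (same₂ l f) (same₁ l f)) tableU)
              -- The right child is the very first vertex after the left subtree, hence `≤-refl`.
              (trans (parents₂ _ ≤-refl) notifiedU) end≤n′
          P : Sequences k (node₂ T U)
          P = λ { root → word j ; (left v) → P₂ v ; (right v) → P₃ v }
      in m₃ , P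
         , (λ { root → sound (S root) j∈ ; (left v) → sol₂ v ; (right v) → sol₃ v })
         , trans (cong (length (word p ∧ word j) +_) (trans (benefit-node₂ P) (cong₂ _+_ opt₂ opt₃))) opt
         , castᴵ (sym (size-node₂ T U))
             (trans (++-assoc (o ++ entry (word j)) _ _)
               (trans (++-assoc o _ _) (cong (o ++_) (sym (concatMap-node₂ (entry ∘ P))))))
             (iter₁ ++ᴵ iter₂ ++ᴵ iter₃)
         , trans m₃0≡ (end-node₂ i T U)
         , (λ l f → trans (same₃ l f) (trans (same₂ l f) (same₁ l f)))
         , (λ l le →
             let le′ = ≤-trans (≤-reflexive (end-node₂ i T U)) le
             in trans (parents₃ l le′)
                  (trans (parents₂ l (≤-trans (m≤m+n _ (size U)) le′)) (parents₁ l le)))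

    -- The complete program, its running time and its optimality.

    program : Program
    program = store (lit 0) (inp (lit 0)) ⨾ (while idx collectBody ⨾ while guard distributeBody)

    -- The 4 is the cost of the initial store, and the factor 2 comes from `suc n ≤ n + n` for
    -- positive `n`.
    timeFactor : ℕ
    timeFactor = 4 + 2 * (iterationTime idx collectBody + iterationTime guard distributeBody)

    -- The edge to a fictitious parent carrying the empty word has benefit 0, so `up` at the root is
    -- the optimum of the tree itself. The first loop ends with 0 in cell 0, which is where the
    -- second has to start.
    optimal : word empty ≡ [] → ∀ T (S : Labels k T) →
      Σ[ P ∈ Sequences k T ] Σ[ t ∈ ℕ ]
          RunsTo program (encodeInput S) (encodeOutput P) t
        × t ≤ timeFactor * size T ^ 3
        × IsSolution S P
        × IsOPT S (benefit P)
    optimal empty≡[] T S =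
      let m₁ , iter₁ , m₁0≡0 , table , parent≡ , _ = collect {o = []} T S reads (update-same (λ _ → 0) 0 (size T))
          m₂ , P , sol , opt , iter₂ , m₂0≡n , _ = distribute {o = []} T S empty reads m₁0≡0 table parent≡ ≤-refl
          t₁ , exec₁ , t₁≤ = runs-while loopFree-collectBody iter₁ m₁0≡0
          t₂ , exec₂ , t₂≤ = runs-while loopFree-distributeBody iter₂
                               (trans (cong (size T ∸_) m₂0≡n) (n∸n≡0 (size T)))
          P-optimal : ∀ Q → IsSolution S Q → benefit Q ≤ benefit P
          P-optimal Q solQ = begin
            benefit Q                                    ≡⟨ cong (λ w → length (w ∧ Q root) + benefit Q) empty≡[] ⟨
            length (word empty ∧ Q root) + benefit Q     ≤⟨ benefit≤up T S Q solQ (word empty) ⟩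
            up T S (word empty)                          ≡⟨ opt ⟨
            length (word empty ∧ P root) + benefit P     ≡⟨ cong (λ w → length (w ∧ P root) + benefit P) empty≡[] ⟩
            benefit P                                    ∎
      in P , 4 + (t₁ + t₂)
         , subst (λ I → RunsTo program I (encodeOutput P) (4 + (t₁ + t₂))) (sym (encodeInput≡ S))
                 (m₂ , seq store (seq exec₁ exec₂))
         , time≤ (size>0 T) t₁≤ t₂≤
         , sol
         , (P , sol , refl) , P-optimal
      where
      open ≤-Reasoning
      reads : Reads (size T ∷ treeInput T S) 0 T S
      reads = subst (λ a → InputAt (size T ∷ treeInput T S) (suc a) (treeInput T S)) (sym (*-zeroʳ (suc k)))
                    (inputAt-∷ (size T) _ (inputAt-self (treeInput T S)))
      time≤ : ∀ {n t₁ t₂ c₁ c₂} → 0 < n → t₁ ≤ suc n * c₁ → t₂ ≤ suc n * c₂ →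
              4 + (t₁ + t₂) ≤ (4 + 2 * (c₁ + c₂)) * n ^ 3
      time≤ {n@(suc _)} {t₁} {t₂} {c₁} {c₂} 0<n t₁≤ t₂≤ = begin
        4 + (t₁ + t₂)                    ≤⟨ +-monoʳ-≤ 4 (+-mono-≤ t₁≤ t₂≤) ⟩
        4 + (suc n * c₁ + suc n * c₂)    ≡⟨ cong (4 +_) (*-distribˡ-+ (suc n) c₁ c₂) ⟨
        4 + suc n * (c₁ + c₂)            ≤⟨ +-mono-≤ (m≤n*m 4 n) (*-monoˡ-≤ (c₁ + c₂) (+-monoˡ-≤ n 0<n)) ⟩
        n * 4 + (n + n) * (c₁ + c₂)      ≡⟨ solve 2 (λ n c → n :* con 4 :+ (n :+ n) :* c := (con 4 :+ con 2 :* c) :* n)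
                                              refl n (c₁ + c₂) ⟩
        -- The bound is linear up to here; this step weakens it to a cubic one.
        (4 + 2 * (c₁ + c₂)) * n          ≤⟨ *-monoʳ-≤ (4 + 2 * (c₁ + c₂)) (m≤m*n n (n ^ 2)) ⟩
        (4 + 2 * (c₁ + c₂)) * n ^ 3      ∎
        where open +-*-Solver

-- Words

unique⇒lookup-injective : ∀ {A : Set} {xs : List A} → Unique xs → Injective _≡_ _≡_ (lookup xs)
unique⇒lookup-injective (x∉ ∷ u) {zero}  {zero}  eq = refl
unique⇒lookup-injective (x∉ ∷ u) {zero}  {suc j} eq = contradiction eq (All.lookup x∉ (∈-lookup j))
unique⇒lookup-injective (x∉ ∷ u) {suc i} {zero}  eq = contradiction (sym eq) (All.lookup x∉ (∈-lookup i))
unique⇒lookup-injective (x∉ ∷ u) {suc i} {suc j} eq = cong suc (unique⇒lookup-injective u eq)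

-- Pigeonhole: the positions of a list without repetitions inject into the alphabet. Hence words of
-- length at most `k` include all permutations of label sets.
unique⇒length≤ : ∀ {k} {xs : List (Fin k)} → Unique xs → length xs ≤ k
unique⇒length≤ u = injective⇒≤ (unique⇒lookup-injective u)

mutual
  -- The empty word is the head even for a variable bound, so its index is `zero` by computation.
  wordsUpTo : ∀ k → ℕ → List (List (Fin k))
  wordsUpTo k n = [] ∷ nonemptyWordsUpTo k n

  nonemptyWordsUpTo : ∀ k → ℕ → List (List (Fin k))
  nonemptyWordsUpTo k zero    = []
  nonemptyWordsUpTo k (suc n) = cartesianProductWith _∷_ (allFin k) (wordsUpTo k n)

∈-wordsUpTo : ∀ {k n} {w : List (Fin k)} → length w ≤ n → w ∈ wordsUpTo k n
∈-wordsUpTo {w = []}            _       = here refl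
∈-wordsUpTo {n = suc n} {x ∷ w} (s≤s l) = there (∈-cartesianProductWith⁺ _∷_ (∈-allFin x) (∈-wordsUpTo l))

isPermutationOf? : ∀ {k} (S : Subset k) xs → Dec (IsPermutationOf S xs)
isPermutationOf? S xs = unique? xs ×-dec all? λ x → ⇔-dec (x ∈ˡ? xs) (x ∈ˢ? S)
  where
  open import Data.List.Relation.Unary.Unique.DecPropositional Fin._≟_ using (unique?)
  open import Data.List.Membership.DecPropositional Fin._≟_ using () renaming (_∈?_ to _∈ˡ?_)
  ⇔-dec : ∀ {A B : Set} → Dec A → Dec B → Dec (A ⇔ B)
  ⇔-dec a? b? = map′ (λ (f , g) → mk⇔ f g) (λ e → Equivalence.to e , Equivalence.from e)
                     ((a? →-dec b?) ×-dec (b? →-dec a?))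

permutation-exists : ∀ {k} (S : Subset k) → ∃[ w ] IsPermutationOf S w
permutation-exists {k} S =
  filter (_∈ˢ? S) (allFin k)
  , filter⁺ (_∈ˢ? S) (allFin⁺ k)
  , λ x → mk⇔ (proj₂ ∘ ∈-filter⁻ (_∈ˢ? S) {xs = allFin k}) (∈-filter⁺ (_∈ˢ? S) (∈-allFin x))

-- The words, and with them the program and its time constant, are built from `k` before any tree or
-- labelling is given.
optimal-program : ∀ k → Σ[ A ∈ Program ] Σ[ c ∈ ℕ ] (∀ T (S : Labels k T) →
  Σ[ P ∈ Sequences k T ] Σ[ t ∈ ℕ ]
      RunsTo A (encodeInput S) (encodeOutput P) t
    × t ≤ c * size T ^ 3
    × IsSolution S P
    × IsOPT S (benefit P))
optimal-program k = program , timeFactor , optimal refl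
  where
  words : List (List (Fin k))
  words = wordsUpTo k k
  perms : Subset k → List (Fin (length words))
  perms S = filter (isPermutationOf? S ∘ lookup words) (allFin (length words))
  sound : ∀ S {j} → j ∈ perms S → IsPermutationOf S (lookup words j)
  sound S j∈ = proj₂ (∈-filter⁻ (isPermutationOf? S ∘ lookup words) {xs = allFin (length words)} j∈)
  complete : ∀ S {w} → IsPermutationOf S w → ∃[ j ] j ∈ perms S × lookup words j ≡ w
  complete S {w} perm =
    index w∈
    , ∈-filter⁺ (isPermutationOf? S ∘ lookup words) (∈-allFin (index w∈))
                (subst (IsPermutationOf S) w≡ perm)
    , sym w≡
    where
    w∈ : w ∈ words
    w∈ = ∈-wordsUpTo (unique⇒length≤ (proj₁ perm))
    w≡ : w ≡ lookup words (index w∈)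
    w≡ = lookup-index w∈
  nonempty : ∀ S → ∃[ j ] j ∈ perms S
  nonempty S = let j , j∈ , _ = complete S (proj₂ (permutation-exists S)) in j , j∈
  open TreeProgram (lookup words) zero perms
  open Correctness sound complete nonempty

-- From exact optimality to the approximation factors.

fromℕℚ≥0 : ∀ n → ℚ.NonNegative (fromℕℚ n)
fromℕℚ≥0 n = ℚ.normalize-nonNeg n 1

-- Every rational in the cut of the factor lies below some `1 - 1/x` with `x` positive, hence below
-- 1.
1-1/x·n≤n : ∀ X n → (1-1/ X) · n ≤ᴿ fromℕ n
1-1/x·n≤n X n p (q , (x , x>0 , _ , q<) , p<) = ℚ.<-≤-trans p< (begin
  q ℚ.* fromℕℚ n    ≤⟨ ℚ.*-monoʳ-≤-nonNeg (fromℕℚ n) {{fromℕℚ≥0 n}} (ℚ.<⇒≤ q<1) ⟩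
  1ℚ ℚ.* fromℕℚ n   ≡⟨ ℚ.*-identityˡ (fromℕℚ n) ⟩
  fromℕℚ n          ∎)
  where
  open ℚ.≤-Reasoning
  1/x : ℚ
  1/x = (ℚ.1/ x) {{ℚ.pos⇒nonZero x {{x>0}}}}
  1/x>0 : ℚ.0ℚ ℚ.< 1/x
  1/x>0 = ℚ.positive⁻¹ 1/x {{ℚ.1/pos⇒pos x {{x>0}}}}
  q<1 : q ℚ.< 1ℚ
  q<1 = begin-strict
    q                  <⟨ q< ⟩
    1ℚ ℚ.- 1/x         <⟨ ℚ.+-monoʳ-< 1ℚ (ℚ.neg-antimono-< 1/x>0) ⟩
    1ℚ ℚ.- ℚ.0ℚ        ≡⟨ ℚ.+-identityʳ 1ℚ ⟩
    1ℚ                 ∎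

mainTheorem1 : (k : ℕ) →
  (Σ[ A ∈ Program ] Σ[ c ∈ ℕ ]
    ((T : BinaryTree) (S : Labels k T) → 4 < size T →
      Σ[ P ∈ Sequences k T ] Σ[ t ∈ ℕ ] Σ[ opt ∈ ℕ ]
        ( RunsTo A (encodeInput S) (encodeOutput P) t
        × t ≤ c * size T ^ 3
        × IsSolution S P
        × IsOPT S opt
        × (1-1/ (log₂ (log₂ (fromℕ (size T))))) · opt ≤ᴿ fromℕ (benefit P) )))
  ×
  (Σ[ A ∈ Program ] Σ[ c ∈ ℕ ] Σ[ d ∈ ℕ ] Σ[ ε ∈ (ℕ → ℚ) ]
    ( TendsToZero ε
    × ((T : BinaryTree) (S : Labels k T) →
        Σ[ P ∈ Sequences k T ] Σ[ t ∈ ℕ ] Σ[ opt ∈ ℕ ]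
          ( RunsTo A (encodeInput S) (encodeOutput P) t
          × t ≤ c * size T ^ d
          × IsSolution S P
          × IsOPT S opt
          × (1ℚ ℚ.- ε (size T)) ℚ.* fromℕℚ opt ℚ.≤ fromℕℚ (benefit P) ))))
mainTheorem1 k =
  (A , c , λ T S _ →
    let P , t , run , t≤ , sol , opt = correct T S
    in P , t , benefit P , run , t≤ , sol , opt , 1-1/x·n≤n (log₂ (log₂ (fromℕ (size T)))) (benefit P))
  -- The solution is an exact optimum, so the error term can be constantly 0.
  , (A , c , 3 , (λ _ → ℚ.0ℚ) , (λ _ δ>0 → 0 , λ _ _ → δ>0) , λ T S →
    let P , t , run , t≤ , sol , opt = correct T S
    in P , t , benefit P , run , t≤ , sol , opt , ℚ.≤-reflexive (ℚ.*-identityˡ (fromℕℚ (benefit P))))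
  where
  A       = proj₁ (optimal-program k)
  c       = proj₁ (proj₂ (optimal-program k))
  correct = proj₂ (proj₂ (optimal-program k))
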